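{- Let $k$ be a positive integer and $n\ge 0$ an integer. The binomial transform of the higher order Mersenne sequence is given explicitly by $$b_{k,n}=\frac{m_k^{\,n}-2^n}{2^k-1} .$$
   Context: The Mersenne numbers $\{M_n\}_{n\ge 0}$ are defined by $M_0=0$, $M_1=1$, $M_{n+2}=3M_{n+1}-2M_n$, i.e. $M_n=2^n-1$. The Mersenne-Lucas numbers satisfy the same recurrence with $m_0=2$, $m_1=3$, i.e. $m_n=2^n+1$. For a positive integer $k$, the higher order Mersenne numbers are $M_n^{(k)}=M_{kn}/M_k$ for $n=0,1,2,\dots$, and their binomial transform is $b_{k,n}=\sum_{i=0}^{n}\binom{n}{i}M_i^{(k)}$ for $n\ge 0$. $m_k^{\,n}$ denotes the $n$th power of $m_k$. -}

module Defs where

open import Algebra.Bundles using (CommutativeRing)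
import Algebra.Properties.Semiring.Sum as Sum
open import Data.Fin.Base using (toℕ)
open import Data.Integer.Base as ℤ using (ℤ; +_)
import Data.Integer.Properties as ℤ
open import Data.Integer.Solver using (module +-*-Solver)
open import Data.Nat.Base as ℕ using (ℕ; zero; suc)
open import Data.Nat.Combinatorics using (_C_)
import Data.Nat.Properties as ℕ
open import Data.Rational.Base using (ℚ; _*_; _÷_; NonZero)
open import Data.Rational.Literals using (fromℤ)
open import Data.Rational.Properties using (+-*-commutativeRing)
open import Relation.Binary.PropositionalEquality

open Sum (CommutativeRing.semiring +-*-commutativeRing) using (sum⁺-syntax)

-- The Mersenne numbers M and the Mersenne-Lucas numbers m.
M : ℕ → ℤ
M 0             = + 0
M 1             = + 1
M (suc (suc n)) = + 3 ℤ.* M (suc n) ℤ.- + 2 ℤ.* M n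

m : ℕ → ℤ
m 0             = + 2
m 1             = + 3
m (suc (suc n)) = + 3 ℤ.* m (suc n) ℤ.- + 2 ℤ.* m n

M≡2^n-1 : ∀ n → M n ≡ (+ 2) ℤ.^ n ℤ.- + 1
M≡2^n-1 0             = refl
M≡2^n-1 1             = refl
M≡2^n-1 (suc (suc n))
  rewrite M≡2^n-1 (suc n) | M≡2^n-1 n = step ((+ 2) ℤ.^ n)
  where
  step : ∀ x → + 3 ℤ.* (+ 2 ℤ.* x ℤ.- + 1) ℤ.- + 2 ℤ.* (x ℤ.- + 1)
             ≡ + 2 ℤ.* (+ 2 ℤ.* x) ℤ.- + 1
  step = solve 1 (λ x → con (+ 3) :* (con (+ 2) :* x :- con (+ 1)) :- con (+ 2) :* (x :- con (+ 1))
                        := con (+ 2) :* (con (+ 2) :* x) :- con (+ 1)) refl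
    where open +-*-Solver

-- NonZero (fromℤ z) unfolds to ℤ.NonZero z, so the next two lemmas say
-- exactly that the denominators 2ᵏ - 1 and M k do not vanish.
2^k-1-nonZero : ∀ k .{{_ : ℕ.NonZero k}} → NonZero (fromℤ ((+ 2) ℤ.^ k ℤ.- + 1))
2^k-1-nonZero (suc k) = ℤ.≢-nonZero λ eq →
  ℕ.<⇒≢ (ℕ.^-monoʳ-< 2 ℕ.≤-refl (ℕ.z<s {k}))
    (sym (ℤ.+-injective (trans (sym (pos-^ (suc k))) (ℤ.i-j≡0⇒i≡j _ _ eq))))
  where
  pos-^ : ∀ n → (+ 2) ℤ.^ n ≡ + (2 ℕ.^ n)
  pos-^ zero    = refl
  pos-^ (suc n) = trans (cong (+ 2 ℤ.*_) (pos-^ n)) (sym (ℤ.pos-* 2 (2 ℕ.^ n)))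

M-nonZero : ∀ k .{{_ : ℕ.NonZero k}} → NonZero (fromℤ (M k))
M-nonZero k = subst (λ z → NonZero (fromℤ z)) (sym (M≡2^n-1 k)) (2^k-1-nonZero k)

-- M⁽ k ⁾ n is the higher order Mersenne number M_n^{(k)}; b k is the binomial
-- transform of M⁽ k ⁾. In ∑[ i ≤ n ] the index i ranges over Fin (suc n).
M⁽_⁾ : (k : ℕ) .{{_ : ℕ.NonZero k}} → ℕ → ℚ
M⁽ k ⁾ n = (fromℤ (M (k ℕ.* n)) ÷ fromℤ (M k)) {{M-nonZero k}}

b : (k : ℕ) .{{_ : ℕ.NonZero k}} → ℕ → ℚ
b k n = ∑[ i ≤ n ] (fromℤ (+ (n C toℕ i)) * M⁽ k ⁾ (toℕ i))

{-# OPTIONS --safe #-}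
-- With x = 2ᵏ we have M (k i) = xⁱ − 1ⁱ, so the binomial theorem, applied at x
-- and at 1, evaluates the transform of i ↦ M (k i) over ℤ to (x + 1)ⁿ − 2ⁿ.
-- Dividing by M k = 2ᵏ − 1 commutes with the sum.
module Submission where

open import Defs
open import Algebra.Bundles using (CommutativeRing)
import Algebra.Properties.CommutativeSemiring.Binomial as Binomial
import Algebra.Properties.Semiring.Exp as Exp
import Algebra.Properties.Semiring.Mult as Mult
import Algebra.Properties.Semiring.Sum as Sum
open import Data.Fin.Base using (Fin; zero; suc; toℕ)
open import Data.Integer.Base using (ℤ; +_; _+_; _-_; _*_; _^_)
import Data.Integer.Properties as ℤ
open import Data.Integer.Solver using (module +-*-Solver)
open import Data.Nat.Base as ℕ using (ℕ; zero; suc; NonZero; _∸_)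
open import Data.Nat.Combinatorics using (_C_)
import Data.Rational.Base as ℚ
open import Data.Rational.Base using (_÷_)
open import Data.Rational.Literals using (fromℤ)
import Data.Rational.Properties as ℚ
import Data.Rational.Unnormalised.Base as ℚᵘ
import Data.Rational.Unnormalised.Properties as ℚᵘ
open import Function.Base using (_∘_)
open import Relation.Binary.PropositionalEquality
  using (_≡_; refl; sym; trans; cong; cong₂; module ≡-Reasoning)

open Sum ℤ.+-*-semiring using (sum; sum-cong-≗; ∑-distrib-+; sum⁺-syntax)
module ∑ℚ = Sum (CommutativeRing.semiring ℚ.+-*-commutativeRing)
open Exp ℤ.+-*-semiring using () renaming (_^_ to _^ˢ_)
open Mult ℤ.+-*-semiring using (_×_)
open ≡-Reasoning

m≡2^n+1 : ∀ n → m n ≡ (+ 2) ^ n + + 1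
m≡2^n+1 0             = refl
m≡2^n+1 1             = refl
m≡2^n+1 (suc (suc n))
  rewrite m≡2^n+1 (suc n) | m≡2^n+1 n = step ((+ 2) ^ n)
  where
  step : ∀ x → + 3 * (+ 2 * x + + 1) - + 2 * (x + + 1) ≡ + 2 * (+ 2 * x) + + 1
  step = solve 1 (λ x → con (+ 3) :* (con (+ 2) :* x :+ con (+ 1)) :- con (+ 2) :* (x :+ con (+ 1))
                        := con (+ 2) :* (con (+ 2) :* x) :+ con (+ 1)) refl
    where open +-*-Solver

-- The general binomial theorem is stated with semiring powers and repeated addition; this and
-- `×≡pos*` translate its terms into integer arithmetic.
^ˢ≡^ : ∀ x n → x ^ˢ n ≡ x ^ n
^ˢ≡^ x zero    = refl
^ˢ≡^ x (suc n) = cong (x *_) (^ˢ≡^ x n)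

×≡pos* : ∀ n x → n × x ≡ + n * x
×≡pos* zero    x = refl
×≡pos* (suc n) x = trans (cong (λ y → x + y) (×≡pos* n x)) (sym (ℤ.suc-* (+ n) x))

-- The binomial theorem with second summand 1, whose powers drop out of every term.
∑-nCi*x^i : ∀ n x → ∑[ i ≤ n ] (+ (n C toℕ i) * x ^ toℕ i) ≡ (x + + 1) ^ n
∑-nCi*x^i n x = begin
  ∑[ i ≤ n ] (+ (n C toℕ i) * x ^ toℕ i)  ≡⟨ sum-cong-≗ term ⟨
  binomialExpansion x (+ 1) n             ≡⟨ theorem n x (+ 1) ⟨
  (x + + 1) ^ˢ n                          ≡⟨ ^ˢ≡^ (x + + 1) n ⟩
  (x + + 1) ^ n                           ∎
  where
  open Binomial ℤ.+-*-commutativeSemiring using (binomialExpansion; binomialTerm; theorem)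
  term : ∀ i → binomialTerm x (+ 1) n i ≡ + (n C toℕ i) * x ^ toℕ i
  term i = trans (×≡pos* (n C toℕ i) _) (cong (+ (n C toℕ i) *_) (begin
    x ^ˢ toℕ i * (+ 1) ^ˢ (n ∸ toℕ i)
      ≡⟨ cong₂ _*_ (^ˢ≡^ x (toℕ i)) (trans (^ˢ≡^ (+ 1) (n ∸ toℕ i)) (ℤ.^-zeroˡ (n ∸ toℕ i))) ⟩
    x ^ toℕ i * + 1
      ≡⟨ ℤ.*-identityʳ _ ⟩
    x ^ toℕ i ∎))

∑-nCi*M[ki] : ∀ k n → ∑[ i ≤ n ] (+ (n C toℕ i) * M (k ℕ.* toℕ i)) ≡ m k ^ n - (+ 2) ^ n
∑-nCi*M[ki] k n = begin
  -- Semiring sums distribute over addition only, so the contribution of the -1 in `M` is restored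
  -- by adding `B` inside the sum and subtracting it outside.
  A                  ≡⟨ a≡[a+b]-b A B ⟩
  A + B - B          ≡⟨ cong (_- B) (∑-distrib-+ f g) ⟨
  ∑[ i ≤ n ] (f i + g i) - B
                     ≡⟨ cong (_- B) (sum-cong-≗ f+g) ⟩
  ∑[ i ≤ n ] (+ (n C toℕ i) * ((+ 2) ^ k) ^ toℕ i) - B
                     -- At x = 1 the base `+ 1 + + 1` computes to `+ 2`.
                     ≡⟨ cong₂ _-_ (∑-nCi*x^i n ((+ 2) ^ k)) (∑-nCi*x^i n (+ 1)) ⟩
  ((+ 2) ^ k + + 1) ^ n - (+ 2) ^ n
                     ≡⟨ cong (λ z → z ^ n - (+ 2) ^ n) (m≡2^n+1 k) ⟨
  m k ^ n - (+ 2) ^ n ∎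
  where
  f g : Fin (suc n) → ℤ
  f i = + (n C toℕ i) * M (k ℕ.* toℕ i)
  -- The factor 1ⁱ is kept so that `B` is literally the binomial sum at x = 1.
  g i = + (n C toℕ i) * (+ 1) ^ toℕ i
  A = sum f
  B = sum g
  open +-*-Solver
  a≡[a+b]-b : ∀ x y → x ≡ x + y - y
  a≡[a+b]-b = solve 2 (λ x y → x := x :+ y :- y) refl
  c[y-1]+c : ∀ c y → c * (y - + 1) + c * + 1 ≡ c * y
  c[y-1]+c = solve 2 (λ c y → c :* (y :- con (+ 1)) :+ c :* con (+ 1) := c :* y) refl
  f+g : ∀ i → f i + g i ≡ + (n C toℕ i) * ((+ 2) ^ k) ^ toℕ i
  -- The last rewrite turns (2ᵏ)ⁱ into the power with exponent k i, so both sides share one atom.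
  f+g i rewrite M≡2^n-1 (k ℕ.* toℕ i) | ℤ.^-zeroˡ (toℕ i) | ℤ.^-*-assoc (+ 2) k (toℕ i) =
    c[y-1]+c (+ (n C toℕ i)) ((+ 2) ^ (k ℕ.* toℕ i))

-- Normalisation is avoided by passing to unnormalised fractions: all denominators are 1, and
-- cross-multiplying leaves only factors of 1 to remove.
fromℤ-homo-+ : ∀ x y → fromℤ (x + y) ≡ fromℤ x ℚ.+ fromℤ y
fromℤ-homo-+ x y = ℚ.toℚᵘ-injective (ℚᵘ.≃-trans
  (ℚᵘ.*≡* (cong (_* + 1) (sym (cong₂ _+_ (ℤ.*-identityʳ x) (ℤ.*-identityʳ y)))))
  (ℚᵘ.≃-sym (ℚ.toℚᵘ-homo-+ (fromℤ x) (fromℤ y))))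

fromℤ-homo-* : ∀ x y → fromℤ (x * y) ≡ fromℤ x ℚ.* fromℤ y
fromℤ-homo-* x y = ℚ.toℚᵘ-injective
  (ℚᵘ.≃-sym (ℚ.toℚᵘ-homo-* (fromℤ x) (fromℤ y)))

fromℤ-homo-sum : ∀ {n} (f : Fin n → ℤ) → fromℤ (sum f) ≡ ∑ℚ.sum (fromℤ ∘ f)
fromℤ-homo-sum {zero}  f = refl
fromℤ-homo-sum {suc n} f = trans (fromℤ-homo-+ (f zero) (sum (f ∘ suc)))
  (cong (fromℤ (f zero) ℚ.+_) (fromℤ-homo-sum (f ∘ suc)))

-- The nonzero proofs are irrelevant, so a denominator can be replaced by an equal one that carries
-- a different proof.
÷-cong : ∀ {p p′ q q′} .{{_ : ℚ.NonZero q}} .{{_ : ℚ.NonZero q′}} →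
         p ≡ p′ → q ≡ q′ → p ÷ q ≡ p′ ÷ q′
÷-cong refl refl = refl

theorem2p23 : ∀ (k : ℕ) .{{_ : NonZero k}} (n : ℕ) →
    b k n ≡ (fromℤ (m k ^ n - (+ 2) ^ n) ÷ fromℤ ((+ 2) ^ k - + 1)) {{2^k-1-nonZero k}}
theorem2p23 k n = begin
  b k n
    ≡⟨ ∑ℚ.sum-cong-≗ term ⟩
  ∑ℚ.sum (λ i → fromℤ (f i) ÷ fromℤ (M k))
    -- `÷` unfolds to multiplication by the reciprocal, a common right factor of all terms.
    ≡⟨ ∑ℚ.*-distribʳ-sum (ℚ.1/ fromℤ (M k)) (fromℤ ∘ f) ⟨
  ∑ℚ.sum (fromℤ ∘ f) ÷ fromℤ (M k)
    ≡⟨ ÷-cong (trans (sym (fromℤ-homo-sum f)) (cong fromℤ (∑-nCi*M[ki] k n)))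
              (cong fromℤ (M≡2^n-1 k)) ⟩
  fromℤ (m k ^ n - (+ 2) ^ n) ÷ fromℤ ((+ 2) ^ k - + 1) ∎
  where
  instance
    _ = M-nonZero k
    _ = 2^k-1-nonZero k
  f : Fin (suc n) → ℤ
  f i = + (n C toℕ i) * M (k ℕ.* toℕ i)
  term : ∀ i → fromℤ (+ (n C toℕ i)) ℚ.* M⁽ k ⁾ (toℕ i) ≡ fromℤ (f i) ÷ fromℤ (M k)
  term i = begin
    fromℤ (+ (n C toℕ i)) ℚ.* (fromℤ (M (k ℕ.* toℕ i)) ÷ fromℤ (M k))
      ≡⟨ ℚ.*-assoc (fromℤ (+ (n C toℕ i))) (fromℤ (M (k ℕ.* toℕ i))) (ℚ.1/ fromℤ (M k)) ⟨
    fromℤ (+ (n C toℕ i)) ℚ.* fromℤ (M (k ℕ.* toℕ i)) ÷ fromℤ (M k)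
      ≡⟨ cong (_÷ fromℤ (M k)) (fromℤ-homo-* (+ (n C toℕ i)) (M (k ℕ.* toℕ i))) ⟨
    fromℤ (f i) ÷ fromℤ (M k) ∎
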